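{- Let $(T,\eta,\mu)$ be a monad on $\mathsf{Set}$ and $F$ a polynomial functor with finite coproducts. Let $g\colon T((-)+(-))\Rightarrow T(-)+T(-)$ be a natural transformation (of bifunctors) that is compatible with the unit and with the multiplication of $T$, and for each constant functor $K_B$ occurring in $F$ let a $T$-algebra $\zeta^B\colon TB\to B$ be chosen. Then the natural transformation $\zeta^F\colon TF\Rightarrow FT$ constructed recursively from these data is an EM-law (distributive law) of $T$ over $F$, i.e. $\zeta^F_X\circ\eta_{FX}=F\eta_X$ and $F\mu_X\circ\zeta^F_{TX}\circ T\zeta^F_X=\zeta^F_X\circ\mu_{FX}$ for all sets $X$.
   Context: Polynomial functors with finite coproducts are generated by $F::=K_B\mid\mathrm{Id}\mid\prod_{i\in I}F_i\mid F_1+F_2$, where $K_B$ is the constant functor at a set $B$ and $I$ is an arbitrary index set. The transformation $\zeta^F$ is defined recursively: for $F=K_B$, $\zeta^F_X=\zeta^B\colon TB\to B$; for $F=\mathrm{Id}$, $\zeta^F=\mathrm{id}_T$; for $F=\prod_{i\in I}F_i$, $\zeta^F_X=\langle\zeta^{F_i}_X\circ T\pi_i\rangle_{i\in I}\colon T\prod_iF_iX\to\prod_iF_iTX$ with $\pi_i$ the projections; for $F=F_1+F_2$, $\zeta^F_X=(\zeta^{F_1}_X+\zeta^{F_2}_X)\circ g_{F_1X,F_2X}\colon T(F_1X+F_2X)\to TF_1X+TF_2X\to F_1TX+F_2TX$. The transformation $g$ is compatible with the unit if $g_{Y_1,Y_2}\circ\eta_{Y_1+Y_2}=\eta_{Y_1}+\eta_{Y_2}$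 for all sets $Y_1,Y_2$, and compatible with the multiplication if $g_{Y_1,Y_2}\circ\mu_{Y_1+Y_2}=(\mu_{Y_1}+\mu_{Y_2})\circ g_{TY_1,TY_2}\circ Tg_{Y_1,Y_2}$ for all sets $Y_1,Y_2$. -}

module Defs where

open import Function using (id; _∘_)
open import Data.Sum using (_⊎_; inj₁; inj₂)
import Data.Sum as Sum
open import Data.Product using (_×_)
open import Relation.Binary.PropositionalEquality using (_≡_)

record Monad : Set₁ where
  field
    T      : Set → Set
    fmap   : {X Y : Set} → (X → Y) → T X → T Y
    fmap-id : {X : Set} (t : T X) → fmap id t ≡ t
    fmap-∘  : {X Y Z : Set} (f : Y → Z) (h : X → Y) (t : T X) →
              fmap (f ∘ h) t ≡ fmap f (fmap h t)
    η      : {X : Set} → X → T X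
    μ      : {X : Set} → T (T X) → T X
    η-nat  : {X Y : Set} (f : X → Y) (x : X) → fmap f (η x) ≡ η (f x)
    μ-nat  : {X Y : Set} (f : X → Y) (t : T (T X)) →
             fmap f (μ t) ≡ μ (fmap (fmap f) t)
    unit-l : {X : Set} (t : T X) → μ (η t) ≡ t
    unit-r : {X : Set} (t : T X) → μ (fmap η t) ≡ t
    assoc  : {X : Set} (t : T (T (T X))) → μ (μ t) ≡ μ (fmap μ t)

module _ (M : Monad) where
  open Monad M

  record EMAlg (B : Set) : Set where
    field
      alg   : T B → B
      alg-η : (b : B) → alg (η b) ≡ b
      alg-μ : (t : T (T B)) → alg (μ t) ≡ alg (fmap alg t)

  data Poly : Set₁ where
    K   : (B : Set) → EMAlg B → Poly
    Id  : Poly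
    Π′  : (I : Set) → (I → Poly) → Poly
    _⊕_ : Poly → Poly → Poly

  ⟦_⟧ : Poly → Set → Set
  ⟦ K B _ ⟧ X = B
  ⟦ Id ⟧ X = X
  ⟦ Π′ I F ⟧ X = (i : I) → ⟦ F i ⟧ X
  ⟦ F ⊕ G ⟧ X = ⟦ F ⟧ X ⊎ ⟦ G ⟧ X

  fmapP : (F : Poly) {X Y : Set} → (X → Y) → ⟦ F ⟧ X → ⟦ F ⟧ Y
  fmapP (K B _) f b = b
  fmapP Id f x = f x
  fmapP (Π′ I F) f p = λ i → fmapP (F i) f (p i)
  fmapP (F ⊕ G) f s = Sum.map (fmapP F f) (fmapP G f) s

  SumDist : Set₁
  SumDist = {Y₁ Y₂ : Set} → T (Y₁ ⊎ Y₂) → T Y₁ ⊎ T Y₂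

  IsNaturalSumDist : SumDist → Set₁
  IsNaturalSumDist g = {X₁ X₂ Y₁ Y₂ : Set} (f₁ : X₁ → Y₁) (f₂ : X₂ → Y₂)
    (t : T (X₁ ⊎ X₂)) →
    g (fmap (Sum.map f₁ f₂) t) ≡ Sum.map (fmap f₁) (fmap f₂) (g t)

  CompatUnit : SumDist → Set₁
  CompatUnit g = {Y₁ Y₂ : Set} (y : Y₁ ⊎ Y₂) → g (η y) ≡ Sum.map η η y

  CompatMult : SumDist → Set₁
  CompatMult g = {Y₁ Y₂ : Set} (t : T (T (Y₁ ⊎ Y₂))) →
    g (μ t) ≡ Sum.map μ μ (g (fmap g t))

  ζ : SumDist → (F : Poly) {X : Set} → T (⟦ F ⟧ X) → ⟦ F ⟧ (T X)
  ζ g (K B a) t = EMAlg.alg a t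
  ζ g Id t = t
  ζ g (Π′ I F) t = λ i → ζ g (F i) (fmap (λ p → p i) t)
  ζ g (F ⊕ G) t = Sum.map (ζ g F) (ζ g G) (g t)

  IsEMLaw : (F : Poly) → ({X : Set} → T (⟦ F ⟧ X) → ⟦ F ⟧ (T X)) → Set₁
  IsEMLaw F z =
    ({X : Set} (x : ⟦ F ⟧ X) → z (η x) ≡ fmapP F η x)
    × ({X : Set} (t : T (T (⟦ F ⟧ X))) →
         fmapP F μ (z (fmap z t)) ≡ z (μ t))

{-# OPTIONS --safe #-}
-- Constants hold by the algebra laws of ζ^B and Id
-- by the monad laws; a product satisfies them componentwise, because projecting after ζ^Π is
-- ζ^{F_i} after projecting; and a coproduct is reduced to its summands by pushing η resp. μ
-- through g with the compatibility laws, naturality of g moving the inner ζ's out of the way.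
module Submission where

open import Defs
open import Level using (0ℓ)
open import Axiom.Extensionality.Propositional using (Extensionality)
open import Function using (_∘′_)
import Data.Sum as Sum
open import Data.Sum.Properties using (map-map; map-cong)
open import Data.Product using (_,_)
open import Relation.Binary.PropositionalEquality
open ≡-Reasoning

module _ (M : Monad) (g : SumDist M) where
  open Monad M

  private
    ⟪_⟫ : Poly M → Set → Set
    ⟪ F ⟫ = ⟦_⟧ M F

    ζᵍ : (F : Poly M) {X : Set} → T (⟪ F ⟫ X) → ⟪ F ⟫ (T X)
    ζᵍ = ζ M g

  ζ-η : Extensionality 0ℓ 0ℓ → CompatUnit M g →
        (F : Poly M) {X : Set} (x : ⟪ F ⟫ X) → ζᵍ F (η x) ≡ fmapP M F η x
  ζ-η ext g-η (K B a) x = EMAlg.alg-η a x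
  ζ-η ext g-η Id x = refl
  ζ-η ext g-η (Π′ I F) x = ext λ i → begin
    ζᵍ (F i) (fmap (λ p → p i) (η x))  ≡⟨ cong (ζᵍ (F i)) (η-nat (λ p → p i) x) ⟩
    ζᵍ (F i) (η (x i))                 ≡⟨ ζ-η ext g-η (F i) (x i) ⟩
    fmapP M (F i) η (x i)              ∎
  ζ-η ext g-η (F ⊕ G) x = begin
    ζᵍ (F ⊕ G) (η x)                          ≡⟨ cong (Sum.map (ζᵍ F) (ζᵍ G)) (g-η x) ⟩
    Sum.map (ζᵍ F) (ζᵍ G) (Sum.map η η x)     ≡⟨ map-map x ⟩
    Sum.map (ζᵍ F ∘′ η) (ζᵍ G ∘′ η) x         ≡⟨ map-cong (ζ-η ext g-η F) (ζ-η ext g-η G) x ⟩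
    Sum.map (fmapP M F η) (fmapP M G η) x     ∎

  fmap-proj-ζΠ : (I : Set) (F : I → Poly M) (i : I) {X : Set}
                 (t : T (T (⟪ Π′ I F ⟫ X))) →
                 fmap (λ p → p i) (fmap (ζᵍ (Π′ I F)) t)
                   ≡ fmap (ζᵍ (F i)) (fmap (fmap (λ p → p i)) t)
  fmap-proj-ζΠ I F i t = begin
    fmap (λ p → p i) (fmap (ζᵍ (Π′ I F)) t)          ≡⟨ fmap-∘ (λ p → p i) (ζᵍ (Π′ I F)) t ⟨
    fmap (λ u → ζᵍ (F i) (fmap (λ p → p i) u)) t     ≡⟨ fmap-∘ (ζᵍ (F i)) (fmap (λ p → p i)) t ⟩
    fmap (ζᵍ (F i)) (fmap (fmap (λ p → p i)) t)      ∎

  ζ-μ : Extensionality 0ℓ 0ℓ → IsNaturalSumDist M g → CompatMult M g →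
        (F : Poly M) {X : Set} (t : T (T (⟪ F ⟫ X))) →
        fmapP M F μ (ζᵍ F (fmap (ζᵍ F) t)) ≡ ζᵍ F (μ t)
  ζ-μ ext g-nat g-μ (K B a) t = sym (EMAlg.alg-μ a t)
  ζ-μ ext g-nat g-μ Id t = cong μ (fmap-id t)
  ζ-μ ext g-nat g-μ (Π′ I F) t = ext λ i → begin
    fmapP M (F i) μ (ζᵍ (F i) (fmap (λ p → p i) (fmap (ζᵍ (Π′ I F)) t)))
      ≡⟨ cong (fmapP M (F i) μ ∘′ ζᵍ (F i)) (fmap-proj-ζΠ I F i t) ⟩
    fmapP M (F i) μ (ζᵍ (F i) (fmap (ζᵍ (F i)) (fmap (fmap (λ p → p i)) t)))
      ≡⟨ ζ-μ ext g-nat g-μ (F i) (fmap (fmap (λ p → p i)) t) ⟩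
    ζᵍ (F i) (μ (fmap (fmap (λ p → p i)) t))
      ≡⟨ cong (ζᵍ (F i)) (μ-nat (λ p → p i) t) ⟨
    ζᵍ (F i) (fmap (λ p → p i) (μ t))
      ∎
  ζ-μ ext g-nat g-μ (F ⊕ G) t = begin
    fmapP M (F ⊕ G) μ (ζᵍ (F ⊕ G) (fmap (ζᵍ (F ⊕ G)) t))
      ≡⟨ cong (fmapP M (F ⊕ G) μ ∘′ ζᵍ (F ⊕ G)) (fmap-∘ (Sum.map (ζᵍ F) (ζᵍ G)) g t) ⟩
    fmapP M (F ⊕ G) μ (ζᵍ (F ⊕ G) (fmap (Sum.map (ζᵍ F) (ζᵍ G)) (fmap g t)))
      ≡⟨ cong (fmapP M (F ⊕ G) μ ∘′ Sum.map (ζᵍ F) (ζᵍ G)) (g-nat (ζᵍ F) (ζᵍ G) (fmap g t)) ⟩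
    fmapP M (F ⊕ G) μ
      (Sum.map (ζᵍ F) (ζᵍ G) (Sum.map (fmap (ζᵍ F)) (fmap (ζᵍ G)) (g (fmap g t))))
      ≡⟨ trans (map-map (Sum.map (fmap (ζᵍ F)) (fmap (ζᵍ G)) (g (fmap g t))))
               (map-map (g (fmap g t))) ⟩
    Sum.map (fmapP M F μ ∘′ ζᵍ F ∘′ fmap (ζᵍ F)) (fmapP M G μ ∘′ ζᵍ G ∘′ fmap (ζᵍ G))
      (g (fmap g t))
      ≡⟨ map-cong (ζ-μ ext g-nat g-μ F) (ζ-μ ext g-nat g-μ G) (g (fmap g t)) ⟩
    Sum.map (ζᵍ F ∘′ μ) (ζᵍ G ∘′ μ) (g (fmap g t))
      ≡⟨ map-map (g (fmap g t)) ⟨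
    Sum.map (ζᵍ F) (ζᵍ G) (Sum.map μ μ (g (fmap g t)))
      ≡⟨ cong (Sum.map (ζᵍ F) (ζᵍ G)) (g-μ t) ⟨
    ζᵍ (F ⊕ G) (μ t)
      ∎

mainTheorem10 : (M : Monad) → Extensionality 0ℓ 0ℓ →
    (g : SumDist M) → IsNaturalSumDist M g → CompatUnit M g → CompatMult M g →
    (F : Poly M) → IsEMLaw M F (ζ M g F)
mainTheorem10 M ext g g-nat g-η g-μ F = ζ-η M g ext g-η F , ζ-μ M g ext g-nat g-μ F
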